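{- Let $(A,\gamma)$ be a quasiordered set. If $\mathrm{hsdim}(A,\gamma)=1$, then $\gamma$ is a half-space, and $\dim\bigl(A/(\gamma\cap\gamma^{ -1}),r_\gamma\bigr)=1$ if $\gamma$ has no empty box with more than one element, while $\dim\bigl(A/(\gamma\cap\gamma^{ -1}),r_\gamma\bigr)=2$ if $\gamma$ has an empty box with more than one element. If $\mathrm{hsdim}(A,\gamma)\ge2$, then $\dim\bigl(A/(\gamma\cap\gamma^{ -1}),r_\gamma\bigr)=\mathrm{hsdim}(A,\gamma)$.
   Context: A quasiorder on $A$ is a reflexive and transitive relation; $\Delta_A=\{(a,a)\mid a\in A\}$. A quasiorder $\alpha$ on $A$ is a half-space if there is a quasiorder $\beta$ on $A$ with $\alpha\cup\beta=A\times A$ and $\alpha\cap\beta=\Delta_A$; then $\beta=\Delta_A\cup((A\times A)\setminus\alpha)$. The boxes of a half-space $\alpha$ are the classes of the equivalence relation $\varepsilon=(\alpha\cap\alpha^{ -1})\cup(\beta\cap\beta^{ -1})$; a box $B$ is empty if $\alpha\cap(B\times B)=\Delta_B$ and full if $|B|>1$ and $B\times B\subseteq\alpha$ (every box is either full or empty). A half-space realizer of a quasiorder $\gamma$ on $A$ is a set $\{\alpha_i\mid i\in I\}$ of half-spaces on $A$ with $\bigcap_{i\in I}\alpha_i=\gamma$; $\mathrm{hsdim}(A,\gamma)$ is the minimum cardinality of a half-space realizer. $r_\gamma$ is the induced partial order on $A/(\gamma\cap\gamma^{ -1})$: $([a],[b])\in r_\gamma$ iff $(a,b)\in\gamma$.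 $\dim$ denotes order dimension: the least cardinality of a set of linear extensions whose intersection is the given partial order. -}

module Defs where

open import Level using (Level; _⊔_; suc)
open import Data.Product using (_×_; ∃-syntax)
open import Data.Sum using (_⊎_)
open import Function using (flip; _↣_)
open import Relation.Binary.Core using (Rel; _⇒_; _⇔_)
open import Relation.Binary.Definitions using (Universal)
open import Relation.Binary.Structures using (IsPreorder; IsTotalOrder)
open import Relation.Binary.Bundles using (Poset)
open import Relation.Binary.PropositionalEquality using (_≡_; _≢_)
open import Relation.Binary.Construct.Union using (_∪_)
open import Relation.Binary.Construct.Intersection using (_∩_)
import Relation.Binary.Construct.Interior.Symmetric as Sym
open import Relation.Unary using (Pred; _∈_; _≐_)

-- Excluded middle and this form of the axiom of choice are the ambient
-- classical logic of order-dimension theory; they enter the theorem as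
-- hypotheses.  The empty chain is included, so P is inhabited.
ZornsLemma : (c ℓ₁ ℓ₂ p : Level) → Set (suc (c ⊔ ℓ₁ ⊔ ℓ₂ ⊔ p))
ZornsLemma c ℓ₁ ℓ₂ p =
  (P : Poset c ℓ₁ ℓ₂) → let open Poset P in
  ((C : Pred Carrier p) →
    (∀ {x y} → x ∈ C → y ∈ C → x ≤ y ⊎ y ≤ x) →
    ∃[ u ] (∀ {x} → x ∈ C → x ≤ u)) →
  ∃[ m ] (∀ {x} → m ≤ x → m ≈ x)

IsQuasiorder : ∀ {a ℓ} {A : Set a} → Rel A ℓ → Set (a ⊔ ℓ)
IsQuasiorder = IsPreorder _≡_

⋂ : ∀ {a ℓ i} {A : Set a} {I : Set i} → (I → Rel A ℓ) → Rel A (i ⊔ ℓ)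
⋂ {I = I} α x y = (i : I) → α i x y

record IsHalfSpace {ℓ} {A : Set ℓ} (α : Rel A ℓ) : Set (suc ℓ) where
  field
    isQuasiorder : IsQuasiorder α
    β            : Rel A ℓ
    β-quasiorder : IsQuasiorder β
    α∪β          : Universal (α ∪ β)
    α∩β          : (α ∩ β) ⇔ _≡_

module Boxes {ℓ} {A : Set ℓ} {α : Rel A ℓ} (h : IsHalfSpace α) where
  open IsHalfSpace h using (β)

  ε : Rel A ℓ
  ε = (α ∩ flip α) ∪ (β ∩ flip β)

  IsBox : Pred A ℓ → Set ℓ
  IsBox B = ∃[ a ] B ≐ ε a

  IsEmptyBox : Pred A ℓ → Set ℓ
  IsEmptyBox B = IsBox B ×
    (λ x y → α x y × (x ∈ B × y ∈ B)) ⇔ (λ x y → x ≡ y × x ∈ B)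

  HasNontrivialEmptyBox : Set (suc ℓ)
  HasNontrivialEmptyBox =
    ∃[ B ] IsEmptyBox B × (∃[ x ] ∃[ y ] x ∈ B × y ∈ B × x ≢ y)

open Boxes public using (HasNontrivialEmptyBox)

-- A set of relations satisfying K with intersection γ, presented without
-- repetitions by the index type I, so that its cardinality is that of I.
-- The set is required to be nonempty; this matters only if γ relates all
-- pairs, where it makes the dimension 1 rather than 0.
record Realizer {ℓ k} {A : Set ℓ} (K : Pred (Rel A ℓ) k) (γ : Rel A ℓ)
                (I : Set ℓ) : Set (suc ℓ ⊔ k) where
  field
    member       : I → Rel A ℓ
    member-K     : ∀ i → K (member i)
    distinct     : ∀ {i j} → member i ⇔ member j → i ≡ j
    nonempty     : I
    intersection : ⋂ member ⇔ γ

-- I represents the minimum cardinality of a realizer.  Cardinals are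
-- represented by types, with _↣_ (existence of an injection) as their order.
MinRealizerCard : ∀ {ℓ k} {A : Set ℓ} → Pred (Rel A ℓ) k → Rel A ℓ →
                  Set ℓ → Set (suc ℓ ⊔ k)
MinRealizerCard {ℓ} K γ I =
  Realizer K γ I × ((J : Set ℓ) → Realizer K γ J → I ↣ J)

Hsdim≡ : ∀ {ℓ} {A : Set ℓ} → Rel A ℓ → Set ℓ → Set (suc ℓ)
Hsdim≡ = MinRealizerCard IsHalfSpace

IsLinearExtension : ∀ {ℓ} (P : Poset ℓ ℓ ℓ) → Rel (Poset.Carrier P) ℓ → Set ℓ
IsLinearExtension P L = IsTotalOrder _≈_ L × _≤_ ⇒ L
  where open Poset P

Dim≡ : ∀ {ℓ} → Poset ℓ ℓ ℓ → Set ℓ → Set (suc ℓ)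
Dim≡ P = MinRealizerCard (IsLinearExtension P) (Poset._≤_ P)

-- (A/(γ ∩ γ⁻¹), r_γ): the quotient is the setoid on A whose equality is
-- γ ∩ γ⁻¹, and r_γ is γ itself on representatives.
quotientPoset : ∀ {ℓ} {A : Set ℓ} {γ : Rel A ℓ} → IsQuasiorder γ → Poset ℓ ℓ ℓ
quotientPoset {γ = γ} q =
  Sym.poset {R = γ} (IsPreorder.refl q) (IsPreorder.trans q)

{-# OPTIONS --safe #-}

-- The boxes of a half-space α are linearly ordered, so a family of
-- half-spaces αᵢ with intersection γ becomes a family of linear extensions
-- of γ once each box is ordered.  The box preorders of all the αᵢ intersect
-- in a quasiorder Q; let T be a linear extension of Q and M one of γ.  Order
-- each full box of αᵢ by T and each empty box by the reverse of T.  A pair in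
-- an empty box of some αᵢ that is separated in the same direction by all
-- other αₖ is then separated in the opposite direction.  The pairs that lie
-- in a common box of every αₖ remain; these are ordered by M for one index
-- and by the reverse of M for another, which is why two indices are needed.
-- Conversely a linear extension is a half-space, so a realizer by linear
-- extensions is one by half-spaces.  If γ is itself a half-space with a
-- nontrivial empty box, the construction applies to γ taken twice.
module Submission where

open import Defs
open import Level using (Level; Lift; lift; lower; _⊔_; 0ℓ) renaming (suc to lsuc)
open import Axiom.ExcludedMiddle using (ExcludedMiddle)
open import Data.Bool using (if_then_else_)
open import Data.Empty using (⊥; ⊥-elim)
open import Data.Fin using (Fin; zero; suc)
open import Data.Irrelevant using ([_])
open import Data.Product using (_×_; _,_; proj₁; proj₂; ∃-syntax; Σ-syntax; curry; uncurry)
open import Data.Refinement.Base using (Refinement-syntax; _,_; value)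
open import Data.Sum using (_⊎_; inj₁; inj₂; [_,_]′)
open import Function using (_↣_; mk↣; flip; id; Injection; _∘_)
open import Relation.Binary.Core using (Rel; _⇒_; _⇔_)
open import Relation.Binary.Bundles using (Poset)
open import Relation.Binary.Definitions using (Reflexive; Transitive; Total)
open import Relation.Binary.Structures using (IsPreorder; IsTotalPreorder; IsTotalOrder)
open import Relation.Binary.PropositionalEquality using (_≡_; _≢_; refl; sym; subst; isEquivalence)
import Relation.Binary.Construct.Interior.Symmetric as Sym
open Sym using (lhs≤rhs)
open import Relation.Nullary using (¬_; yes; no; does; contradiction)
open import Relation.Nullary.Decidable using (True; toWitness; fromWitness; decidable-stable; recompute)
open import Relation.Unary using (Pred; _∈_; _⊆_; ｛_｝) renaming (_∪_ to _∪₁_)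

private
  variable
    a ℓ k : Level
    A : Set a

-- Quasiorders and transport of half-spaces.

fromReflTrans : {R : Rel A ℓ} → Reflexive R → Transitive R → IsQuasiorder R
fromReflTrans r t = record
  { isEquivalence = isEquivalence
  ; reflexive     = λ { refl → r }
  ; trans         = t
  }

isTotalPreorder-flip : {R : Rel A ℓ} →
                       IsTotalPreorder _≡_ R → IsTotalPreorder _≡_ (flip R)
isTotalPreorder-flip t = record
  { isPreorder = fromReflTrans P.refl (flip P.trans)
  ; total      = λ x y → P.total y x
  }
  where module P = IsTotalPreorder t

Lex : Rel A ℓ → Rel A ℓ → Rel A ℓ
Lex R S x y = R x y × (R y x → S x y)

isHalfSpace-resp-⇔ : {A : Set ℓ} {α γ : Rel A ℓ} →
                     α ⇔ γ → IsHalfSpace α → IsHalfSpace γ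
isHalfSpace-resp-⇔ (f , g) h = record
  { isQuasiorder = fromReflTrans (f (α.refl))
                                 (λ p r → f (α.trans (g p) (g r)))
  ; β            = β
  ; β-quasiorder = β-quasiorder
  ; α∪β          = λ x y → [ inj₁ ∘ f , inj₂ ]′ (α∪β x y)
  ; α∩β          = (λ (p , r) → proj₁ α∩β (g p , r))
                 , (λ e → let p , r = proj₂ α∩β e in f p , r)
  }
  where
  open IsHalfSpace h
  module α = IsPreorder isQuasiorder

-- Boxes of a half-space and orders inside them.

module HalfSpace {A : Set ℓ} {α : Rel A ℓ} (h : IsHalfSpace α) where
  open IsHalfSpace h public
  open IsPreorder isQuasiorder public using () renaming (refl to α-refl; trans to α-trans)
  open IsPreorder β-quasiorder public using () renaming (refl to β-refl; trans to β-trans)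

  α∧β⇒≡ : ∀ {x y} → α x y → β x y → x ≡ y
  α∧β⇒≡ p r = proj₁ α∩β (p , r)

  -- The order that `α` induces on its boxes: a total preorder whose symmetric part is `ε`.
  BoxPreorder : Rel A ℓ
  BoxPreorder x y = α x y ⊎ (β x y × β y x)

  boxPreorder-trans : Transitive BoxPreorder
  boxPreorder-trans (inj₁ p) (inj₁ r) = inj₁ (α-trans p r)
  boxPreorder-trans {x} {y} {z} (inj₁ p) (inj₂ (r , s)) with α∪β x z | α∪β z x
  ... | inj₁ c | _      = inj₁ c
  ... | inj₂ c | inj₂ d = inj₂ (c , d)
  -- The edge `α z x` yields `α z y`, which together with `β z y` forces `z` to be `y`.
  ... | inj₂ c | inj₁ d with refl ← α∧β⇒≡ (α-trans d p) s = inj₁ p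
  boxPreorder-trans {x} {y} {z} (inj₂ (r , s)) (inj₁ p) with α∪β x z | α∪β z x
  ... | inj₁ c | _      = inj₁ c
  ... | inj₂ c | inj₂ d = inj₂ (c , d)
  ... | inj₂ c | inj₁ d with refl ← α∧β⇒≡ (α-trans p d) s = inj₁ p
  boxPreorder-trans (inj₂ (p , r)) (inj₂ (s , t)) = inj₂ (β-trans p s , β-trans t r)

  -- Full boxes are ordered by T, empty boxes by the reverse of T.
  Refine : Rel A ℓ → Rel A ℓ
  Refine T x y = (α x y × (α y x → T x y)) ⊎ (β x y × β y x × T y x)

  refine⇒boxPreorder : ∀ {T} → Refine T ⇒ BoxPreorder
  refine⇒boxPreorder (inj₁ (p , _))     = inj₁ p
  refine⇒boxPreorder (inj₂ (p , r , _)) = inj₂ (p , r)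

  module _ {T : Rel A ℓ} (T-isTotalPreorder : IsTotalPreorder _≡_ T) where
    private module T = IsTotalPreorder T-isTotalPreorder

    -- In the mixed cases, whenever `α` and `β` both hold along one side, `α∩β` identifies its
    -- endpoints and a given hypothesis becomes the goal.
    refine-trans : Transitive (Refine T)
    refine-trans (inj₁ (p , t)) (inj₁ (q , u)) =
      inj₁ (α-trans p q , λ r → T.trans (t (α-trans q r)) (u (α-trans r p)))
    refine-trans {x} {y} {z} e@(inj₁ (p , t)) f@(inj₂ (q , r , _)) with α∪β x z
    ... | inj₁ c = inj₁ (c , λ d → case-≡ (α∧β⇒≡ (α-trans d p) r) d)
      where
      case-≡ : z ≡ y → α z x → T x z
      case-≡ refl = t
    ... | inj₂ c with refl ← α∧β⇒≡ p (β-trans c r) = f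
    refine-trans {x} {y} {z} e@(inj₂ (q , r , _)) f@(inj₁ (p , t)) with α∪β x z
    ... | inj₁ c = inj₁ (c , λ d → case-≡ (α∧β⇒≡ (α-trans p d) r) d)
      where
      case-≡ : y ≡ x → α z x → T x z
      case-≡ refl = t
    ... | inj₂ c with refl ← α∧β⇒≡ p (β-trans r c) = e
    refine-trans (inj₂ (p , q , t)) (inj₂ (r , s , u)) =
      inj₂ (β-trans p r , β-trans s q , T.trans u t)

    refine-total : Total (Refine T)
    refine-total x y with α∪β x y | α∪β y x | T.total x y
    ... | inj₁ p | inj₁ q | inj₁ t = inj₁ (inj₁ (p , λ _ → t))
    ... | inj₁ p | inj₁ q | inj₂ t = inj₂ (inj₁ (q , λ _ → t))
    ... | inj₂ p | inj₂ q | inj₁ t = inj₂ (inj₂ (q , p , t))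
    ... | inj₂ p | inj₂ q | inj₂ t = inj₁ (inj₂ (p , q , t))
    ... | inj₁ p | inj₂ q | _      = inj₁ (inj₁ (p , λ r → T.reflexive (sym (α∧β⇒≡ r q))))
    ... | inj₂ p | inj₁ q | _      = inj₂ (inj₁ (q , λ r → T.reflexive (sym (α∧β⇒≡ r p))))

    refine-isTotalPreorder : IsTotalPreorder _≡_ (Refine T)
    refine-isTotalPreorder = record
      { isPreorder = fromReflTrans (inj₁ (α-refl , λ _ → T.refl)) refine-trans
      ; total      = refine-total
      }

    -- Boxes of both kinds are ordered by `T` up to direction, so a tie can only come from a tie of
    -- `T`.
    refine-antisym : ∀ {x y} → Refine T x y → Refine T y x → T x y × T y x
    refine-antisym (inj₁ (p , t)) (inj₁ (q , u)) = t q , u p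
    refine-antisym (inj₁ (p , t)) (inj₂ (_ , q , _))
      with refl ← α∧β⇒≡ p q = T.refl , T.refl
    refine-antisym (inj₂ (_ , q , _)) (inj₁ (p , _))
      with refl ← α∧β⇒≡ p q = T.refl , T.refl
    refine-antisym (inj₂ (_ , _ , t)) (inj₂ (_ , _ , u)) = u , t

    boxPreorder⇒refine : ∀ {x y} → BoxPreorder x y → T x y → T y x → Refine T x y
    boxPreorder⇒refine (inj₁ p)       t _ = inj₁ (p , λ _ → t)
    boxPreorder⇒refine (inj₂ (p , q)) _ u = inj₂ (p , q , u)

  open Boxes h using (ε; IsEmptyBox)

  incomparable⇒emptyBox : ∀ {x y} → β x y → β y x → x ≢ y → IsEmptyBox (ε x)
  incomparable⇒emptyBox {x} {y} p q x≢y =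
    (x , id , id)
    , (λ (r , m , n) → α∧β⇒≡ r (β-trans (proj₂ (β-box m)) (proj₁ (β-box n))) , m)
    , (λ { (refl , m) → α-refl , m , m })
    where
    β-box : ∀ {u} → ε x u → β x u × β u x
    β-box (inj₂ b) = b
    -- For `u` tied to `x` by `α`, an `α` edge between `u` and `y` would carry over to `x` and `y`.
    -- So `β` ties `u` to `y`, hence to `x`, and `u` is `x`.
    β-box {u} (inj₁ (r , s)) with α∪β u y | α∪β y u
    ... | inj₁ c | _      = contradiction (α∧β⇒≡ (α-trans r c) p) x≢y
    ... | _      | inj₁ d = contradiction (sym (α∧β⇒≡ (α-trans d s) q)) x≢y
    ... | inj₂ c | inj₂ d with refl ← α∧β⇒≡ s (β-trans c q) = β-refl , β-refl

-- Consequences of excluded middle.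

module _ (em : ∀ {ℓ} → ExcludedMiddle ℓ) where

  -- A union of a chain of predicates lives one universe too high; excluded
  -- middle brings it back down.
  Resize : ∀ ℓ → Set a → Set ℓ
  Resize ℓ P = Lift ℓ (True (em {P = P}))

  resize : {P : Set a} → P → Resize ℓ P
  resize p = lift (fromWitness p)

  unresize : {P : Set a} → Resize ℓ P → P
  unresize r = toWitness (lower r)

  ⋃ : {X : Set ℓ} → Pred (Pred X ℓ) k → Pred X ℓ
  ⋃ {ℓ} C x = Resize ℓ (∃[ S ] S ∈ C × x ∈ S)

  IsChain : {X : Set ℓ} → Pred (Pred X ℓ) k → Set (lsuc ℓ ⊔ k)
  IsChain C = ∀ {S U} → S ∈ C → U ∈ C → S ⊆ U ⊎ U ⊆ S

  lex-isTotalPreorder : {R S : Rel A ℓ} → IsTotalPreorder _≡_ R →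
                        IsTotalPreorder _≡_ S → IsTotalPreorder _≡_ (Lex R S)
  lex-isTotalPreorder {R = R} {S} r s = record
    { isPreorder = fromReflTrans (R.refl , λ _ → S.refl)
        (λ (p , f) (q , g) → R.trans p q ,
          λ t → S.trans (f (R.trans q t)) (g (R.trans t p)))
    ; total      = tot
    }
    where
    module R = IsTotalPreorder r
    module S = IsTotalPreorder s
    tot : Total (Lex R S)
    tot x y with em {P = R x y} | em {P = R y x} | S.total x y
    ... | yes p | yes q | inj₁ t = inj₁ (p , λ _ → t)
    ... | yes p | yes q | inj₂ t = inj₂ (q , λ _ → t)
    ... | yes p | no ¬q | _      = inj₁ (p , λ q → contradiction q ¬q)
    ... | no ¬p | yes q | _      = inj₂ (q , λ p → contradiction p ¬p)
    ... | no ¬p | no ¬q | _      with R.total x y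
    ...   | inj₁ p = contradiction p ¬p
    ...   | inj₂ q = contradiction q ¬q

  -- Totality makes the complement transitive: `¬ L y z` gives `L z y`, so `L x z` would give
  -- `L x y`.
  totalPreorder⇒halfSpace : {A : Set ℓ} {L : Rel A ℓ} → Reflexive L → Transitive L →
                            Total L → IsHalfSpace L
  totalPreorder⇒halfSpace {L = L} L-refl L-trans L-total = record
    { isQuasiorder = fromReflTrans L-refl L-trans
    ; β            = λ x y → x ≡ y ⊎ ¬ L x y
    ; β-quasiorder = fromReflTrans (inj₁ refl) β-trans
    ; α∪β          = universal
    ; α∩β          = (λ { (p , inj₁ e) → e ; (p , inj₂ ¬p) → contradiction p ¬p })
                   , (λ { refl → L-refl , inj₁ refl })
    }
    where
    β-trans : Transitive (λ x y → x ≡ y ⊎ ¬ L x y)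
    β-trans (inj₁ refl) q           = q
    β-trans (inj₂ p)    (inj₁ refl) = inj₂ p
    β-trans {x} {y} {z} (inj₂ p) (inj₂ q) with L-total y z
    ... | inj₁ r = contradiction r q
    ... | inj₂ r = inj₂ (λ s → p (L-trans s r))
    universal : ∀ x y → L x y ⊎ (x ≡ y ⊎ ¬ L x y)
    universal x y with em {P = L x y}
    ... | yes p = inj₁ p
    ... | no ¬p = inj₂ (inj₂ ¬p)

  -- Cantor–Bernstein for an injection f of I into its subset M: the
  -- bijection from I to M is f on the forward orbits of points outside M and
  -- the identity elsewhere.
  module CantorBernstein {I : Set ℓ} {M : Pred I ℓ} (f : I → I)
    (f-injective : ∀ {i j} → f i ≡ f j → i ≡ j) (f∈M : ∀ i → f i ∈ M) where

    data Orbit : Pred I ℓ where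
      start : ∀ {i} → ¬ i ∈ M → Orbit i
      step  : ∀ {i} → Orbit i → Orbit (f i)

    to : I → I
    to i = if does (em {P = Orbit i}) then f i else i

    to∈M : ∀ i → to i ∈ M
    to∈M i with em {P = Orbit i}
    ... | yes _ = f∈M i
    ... | no ¬o = decidable-stable em (λ i∉M → ¬o (start i∉M))

    to-injective : ∀ {i j} → to i ≡ to j → i ≡ j
    to-injective {i} {j} e with em {P = Orbit i} | em {P = Orbit j}
    ... | yes _ | yes _ = f-injective e
    ... | yes o | no ¬o = contradiction (subst Orbit e (step o)) ¬o
    ... | no ¬o | yes o = contradiction (subst Orbit (sym e) (step o)) ¬o
    ... | no _  | no _  = e

    -- A point of `M` on an orbit is no starting point, so it is `f` of an earlier orbit point;
    -- points off the orbits are fixed.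
    to-surjective : ∀ {j} → j ∈ M → ∃[ i ] to i ≡ j
    to-surjective {j} j∈M with em {P = Orbit j}
    ... | yes (start j∉M)  = contradiction j∈M j∉M
    ... | yes (step {i} o) = i , eq
      where
      eq : to i ≡ f i
      eq with em {P = Orbit i}
      ... | yes _ = refl
      ... | no ¬o = contradiction o ¬o
    ... | no ¬o = j , eq
      where
      eq : to j ≡ j
      eq with em {P = Orbit j}
      ... | yes o = contradiction o ¬o
      ... | no _  = refl

  -- Consequences of Zorn's lemma.

  module _ (zorn : ∀ {c ℓ₁ ℓ₂ p} → ZornsLemma c ℓ₁ ℓ₂ p) where

    maximalSubset : {X : Set ℓ} (Φ : Pred (Pred X ℓ) k) (B : Pred X ℓ) → Φ B →
      ((C : Pred (Pred X ℓ) (lsuc ℓ ⊔ k)) → IsChain C → C ⊆ Φ → Φ (⋃ C)) →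
      Σ[ M ∈ Pred X ℓ ] Φ M × B ⊆ M × (∀ {N} → Φ N → M ⊆ N → N ⊆ M)
    maximalSubset {ℓ} {k} {X} Φ B ΦB Φ⋃ =
      let (M , B⊆M , ΦM) , max = zorn {p = 0ℓ} poset bound
      in M , ΦM , B⊆M ,
         λ {N} ΦN M⊆N → proj₂ (max {N , (λ b → M⊆N (B⊆M b)) , ΦN} M⊆N)
      where
      Carrier : Set (lsuc ℓ ⊔ k)
      Carrier = ∃[ S ] B ⊆ S × Φ S

      poset : Poset (lsuc ℓ ⊔ k) ℓ ℓ
      poset = record
        { Carrier        = Carrier
        ; _≈_            = λ S U → proj₁ S ⊆ proj₁ U × proj₁ U ⊆ proj₁ S
        ; _≤_            = λ S U → proj₁ S ⊆ proj₁ U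
        ; isPartialOrder = record
          { isPreorder = record
            { isEquivalence = record
              { refl  = id , id
              ; sym   = λ (f , g) → g , f
              ; trans = λ (f , g) (f′ , g′) → (λ s → f′ (f s)) , (λ u → g (g′ u))
              }
            ; reflexive = λ (f , _) → f
            ; trans     = λ f g s → g (f s)
            }
          ; antisym = λ f g → f , g
          }
        }

      bound : (C : Pred Carrier 0ℓ) →
        (∀ {S U} → S ∈ C → U ∈ C → proj₁ S ⊆ proj₁ U ⊎ proj₁ U ⊆ proj₁ S) →
        ∃[ U ] (∀ {S} → S ∈ C → proj₁ S ⊆ proj₁ U)
      bound C chain = (⋃ C⁺ , (λ b → resize (B , inj₁ refl , b)) , Φ⋃ C⁺ chain⁺ C⁺⊆Φ)
                    , λ { {S , p} c s → resize (S , inj₂ (p , c) , s) }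
        where
        C⁺ : Pred (Pred X ℓ) (lsuc ℓ ⊔ k)
        -- Adding `B` makes the union contain `B` even when `C` is empty.
        C⁺ S = S ≡ B ⊎ (∃[ p ] (S , p) ∈ C)
        chain⁺ : IsChain C⁺
        chain⁺ (inj₁ refl)            (inj₁ refl)           = inj₁ id
        chain⁺ (inj₁ refl)            (inj₂ ((B⊆U , _) , _)) = inj₁ B⊆U
        chain⁺ (inj₂ ((B⊆S , _) , _)) (inj₁ refl)           = inj₂ B⊆S
        chain⁺ (inj₂ (_ , c))         (inj₂ (_ , d))        = chain c d
        C⁺⊆Φ : C⁺ ⊆ Φ
        C⁺⊆Φ (inj₁ refl)            = ΦB
        C⁺⊆Φ (inj₂ ((_ , ΦS) , _)) = ΦS

    -- With-abstractions in the sequel would otherwise unfold these witnesses.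
    abstract
      -- Szpilrajn's extension theorem for quasiorders. The last component says that `T` ties only
      -- what `Q` ties.
      szpilrajn : {A : Set ℓ} {Q : Rel A ℓ} → IsQuasiorder Q →
        Σ[ T ∈ Rel A ℓ ] IsTotalPreorder _≡_ T × Q ⇒ T × (∀ {x y} → T x y → T y x → Q x y)
      szpilrajn {ℓ} {A} {Q} q =
        conclude (maximalSubset Φ (uncurry Q) (Q.trans , λ p _ → p) Φ⋃)
        where
        module Q = IsPreorder q

        Φ : Pred (Pred (A × A) ℓ) ℓ
        Φ S = Transitive (curry S) × (∀ {x y} → S (x , y) → S (y , x) → Q x y)

        Φ⋃ : (C : Pred (Pred (A × A) ℓ) (lsuc ℓ)) → IsChain C → C ⊆ Φ → Φ (⋃ C)
        Φ⋃ C chain C⊆Φ = ⋃-trans , ⋃-antisym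
          where
          common : ∀ {x y} → x ∈ ⋃ C → y ∈ ⋃ C → ∃[ S ] S ∈ C × x ∈ S × y ∈ S
          common p r with unresize p | unresize r
          ... | S , c , s | U , d , u with chain c d
          ...   | inj₁ S⊆U = U , d , S⊆U s , u
          ...   | inj₂ U⊆S = S , c , s , U⊆S u
          ⋃-trans : Transitive (curry (⋃ C))
          ⋃-trans p r with common p r
          ... | S , c , s , t = resize (S , c , proj₁ (C⊆Φ c) s t)
          ⋃-antisym : ∀ {x y} → (x , y) ∈ ⋃ C → (y , x) ∈ ⋃ C → Q x y
          ⋃-antisym p r with common p r
          ... | S , c , s , t = proj₂ (C⊆Φ c) s t

        total : (M : Pred (A × A) ℓ) → Transitive (curry M) →
          (∀ {x y} → M (x , y) → M (y , x) → Q x y) → uncurry Q ⊆ M →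
          (∀ {N} → Φ N → M ⊆ N → N ⊆ M) → Total (curry M)
        total M M-trans M-antisym Q⊆M max a b with em {P = M (b , a)}
        ... | yes ba = inj₂ ba
        ... | no ¬ba = inj₁ (max {N} (N-trans , N-antisym) inj₁ (inj₂ (Q⊆M Q.refl , Q⊆M Q.refl)))
          where
          -- `N` is the transitive closure of `M` with `(a , b)` added; one passage through the new
          -- pair suffices. A cycle through it would put `(b , a)` in `M`.
          N : Pred (A × A) ℓ
          N (x , y) = M (x , y) ⊎ (M (x , a) × M (b , y))
          N-trans : Transitive (curry N)
          N-trans (inj₁ p)       (inj₁ r)       = inj₁ (M-trans p r)
          N-trans (inj₁ p)       (inj₂ (r , s)) = inj₂ (M-trans p r , s)
          N-trans (inj₂ (p , r)) (inj₁ s)       = inj₂ (p , M-trans r s)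
          N-trans (inj₂ (p , r)) (inj₂ (s , t)) = inj₂ (p , t)
          N-antisym : ∀ {x y} → N (x , y) → N (y , x) → Q x y
          N-antisym (inj₁ p)       (inj₁ r)       = M-antisym p r
          N-antisym (inj₁ p)       (inj₂ (r , s)) = contradiction (M-trans s (M-trans p r)) ¬ba
          N-antisym (inj₂ (p , r)) (inj₁ s)       = contradiction (M-trans r (M-trans s p)) ¬ba
          N-antisym (inj₂ (p , r)) (inj₂ (s , t)) = contradiction (M-trans r s) ¬ba

        conclude : (Σ[ M ∈ Pred (A × A) ℓ ] Φ M × uncurry Q ⊆ M × (∀ {N} → Φ N → M ⊆ N → N ⊆ M)) →
          Σ[ T ∈ Rel A ℓ ] IsTotalPreorder _≡_ T × Q ⇒ T × (∀ {x y} → T x y → T y x → Q x y)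
        conclude (M , (M-trans , M-antisym) , Q⊆M , max) =
          curry M
          , record { isPreorder = fromReflTrans (Q⊆M Q.refl) M-trans
                   ; total      = total M M-trans M-antisym Q⊆M max }
          , Q⊆M
          , M-antisym

      -- Take a maximal set of pairwise unrelated indices: an index related to none of them could be
      -- added.
      transversal : {I : Set ℓ} {_∼_ : Rel I ℓ} → Reflexive _∼_ → (∀ {i j} → i ∼ j → j ∼ i) →
        Σ[ M ∈ Pred I ℓ ] (∀ {i j} → i ∈ M → j ∈ M → i ∼ j → i ≡ j) × (∀ i → ∃[ j ] j ∈ M × j ∼ i)
      transversal {ℓ} {I} {_∼_} ∼-refl ∼-sym =
        let M , M-distinct , _ , max = maximalSubset Φ (λ _ → Lift ℓ ⊥) (λ ()) Φ⋃
        in M , M-distinct , covers M M-distinct max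
        where
        Φ : Pred (Pred I ℓ) ℓ
        Φ S = ∀ {i j} → i ∈ S → j ∈ S → i ∼ j → i ≡ j

        Φ⋃ : (C : Pred (Pred I ℓ) (lsuc ℓ)) → IsChain C → C ⊆ Φ → Φ (⋃ C)
        Φ⋃ C chain C⊆Φ p r with unresize p | unresize r
        ... | S , c , s | U , d , u with chain c d
        ...   | inj₁ S⊆U = C⊆Φ d (S⊆U s) u
        ...   | inj₂ U⊆S = C⊆Φ c s (U⊆S u)

        covers : (M : Pred I ℓ) → Φ M → (∀ {N} → Φ N → M ⊆ N → N ⊆ M) →
                 ∀ i → ∃[ j ] j ∈ M × j ∼ i
        covers M ΦM max i with em {P = ∃[ j ] j ∈ M × j ∼ i}
        ... | yes p = p
        ... | no ¬p = i , max {M ∪₁ ｛ i ｝} ΦN inj₁ (inj₂ refl) , ∼-refl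
          where
          ΦN : Φ (M ∪₁ ｛ i ｝)
          ΦN (inj₁ p)    (inj₁ r)    e = ΦM p r e
          ΦN (inj₁ p)    (inj₂ refl) e = contradiction (_ , p , e) ¬p
          ΦN (inj₂ refl) (inj₁ r)    e = contradiction (_ , r , ∼-sym e) ¬p
          ΦN (inj₂ refl) (inj₂ refl) e = refl

    -- Half-space realizers and linear extensions.

    module _ {A : Set ℓ} {γ : Rel A ℓ} (q : IsQuasiorder γ) where
      private
        module γ = IsPreorder q
        P = quotientPoset q

      -- Read on representatives in `A`, a linear extension of the quotient is a total preorder.
      linearExtension⇒halfSpace : ∀ {L} → IsLinearExtension P L → IsHalfSpace L
      linearExtension⇒halfSpace (t , _) = totalPreorder⇒halfSpace L.refl L.trans L.total
        where module L = IsTotalOrder t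

      realizer⇒halfSpaceRealizer : ∀ {J} → Realizer (IsLinearExtension P) γ J →
                                   Realizer IsHalfSpace γ J
      realizer⇒halfSpaceRealizer r = record
        { member       = member
        ; member-K     = λ i → linearExtension⇒halfSpace (member-K i)
        ; distinct     = distinct
        ; nonempty     = nonempty
        ; intersection = intersection
        }
        where open Realizer r

      module LinearExtensions {I : Set ℓ} (α : I → Rel A ℓ)
        (h : ∀ i → IsHalfSpace (α i)) (⋂α⇔γ : ⋂ α ⇔ γ)
        (i₀ i₁ : I) (i₀≢i₁ : i₀ ≢ i₁) where

        private module H i = HalfSpace (h i)

        Q : Rel A ℓ
        Q = ⋂ (λ i → H.BoxPreorder i)

        Q-isQuasiorder : IsQuasiorder Q
        Q-isQuasiorder = fromReflTrans (λ i → inj₁ (H.α-refl i))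
                                       (λ p r i → H.boxPreorder-trans i (p i) (r i))

        private
          szT = szpilrajn Q-isQuasiorder
          szM = szpilrajn q

        T M : Rel A ℓ
        T = proj₁ szT
        M = proj₁ szM

        T-isTotalPreorder : IsTotalPreorder _≡_ T
        T-isTotalPreorder = proj₁ (proj₂ szT)

        M-isTotalPreorder : IsTotalPreorder _≡_ M
        M-isTotalPreorder = proj₁ (proj₂ szM)

        Q⇒T : Q ⇒ T
        Q⇒T = proj₁ (proj₂ (proj₂ szT))

        γ⇒M : γ ⇒ M
        γ⇒M = proj₁ (proj₂ (proj₂ szM))

        T-antisym : ∀ {x y} → T x y → T y x → Q x y
        T-antisym = proj₂ (proj₂ (proj₂ szT))

        M-antisym : ∀ {x y} → M x y → M y x → γ x y
        M-antisym = proj₂ (proj₂ (proj₂ szM))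

        γ⇒α : ∀ i → γ ⇒ α i
        γ⇒α i p = proj₂ ⋂α⇔γ p i

        γ⇒Q : γ ⇒ Q
        γ⇒Q p i = inj₁ (γ⇒α i p)

        -- `N i` breaks the ties of `E i`. It is reversed at `i₁` alone, so `N i₀` and `N i₁` agree
        -- on no pair outside `γ`.
        E N L : I → Rel A ℓ
        E i = H.Refine i T
        N i = if does (em {P = i ≡ i₁}) then flip M else M
        L i = Lex (E i) (N i)

        N-isTotalPreorder : ∀ i → IsTotalPreorder _≡_ (N i)
        N-isTotalPreorder i with em {P = i ≡ i₁}
        ... | yes _ = isTotalPreorder-flip M-isTotalPreorder
        ... | no _  = M-isTotalPreorder

        N-antisym : ∀ i {x y} → N i x y → N i y x → γ x y × γ y x
        N-antisym i p r with em {P = i ≡ i₁}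
        ... | yes _ = M-antisym r p , M-antisym p r
        ... | no _  = M-antisym p r , M-antisym r p

        N-reflexive : ∀ i {x y} → γ x y → γ y x → N i x y
        N-reflexive i p r with em {P = i ≡ i₁}
        ... | yes _ = γ⇒M r
        ... | no _  = γ⇒M p

        N-i₀⇒M : N i₀ ⇒ M
        N-i₀⇒M p with em {P = i₀ ≡ i₁}
        ... | yes e = contradiction e i₀≢i₁
        ... | no _  = p

        N-i₁⇒flip-M : N i₁ ⇒ flip M
        N-i₁⇒flip-M p with em {P = i₁ ≡ i₁}
        ... | yes _ = p
        ... | no ¬e = contradiction refl ¬e

        -- A pair of `γ` lies in every `α i`, so it cannot sit in an empty box unless its points
        -- coincide. Hence `Q y x` amounts to `α i y x` at every `i`.
        Q-sym⇒γ-sym : ∀ {x y} → Q y x → γ x y → γ y x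
        Q-sym⇒γ-sym {x} {y} r p = proj₁ ⋂α⇔γ α-yx
          where
          α-yx : ∀ i → α i y x
          α-yx i with r i
          ... | inj₁ s       = s
          ... | inj₂ (_ , s) with refl ← H.α∧β⇒≡ i (γ⇒α i p) s = H.α-refl i

        γ⇒L : ∀ i → γ ⇒ L i
        -- A tie of `E i` is a tie of `T`, hence of `Q`, hence of `γ`, and `N i` contains the ties
        -- of `γ`.
        γ⇒L i p = E-xy , λ E-yx →
          let t , u = H.refine-antisym i T-isTotalPreorder E-xy E-yx
          in N-reflexive i p (Q-sym⇒γ-sym (T-antisym u t) p)
          where E-xy = inj₁ (γ⇒α i p , λ _ → Q⇒T (γ⇒Q p))

        L-isLinearExtension : ∀ i → IsLinearExtension P (L i)
        L-isLinearExtension i = record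
          { isPartialOrder = record
            { isPreorder = record
              { isEquivalence = Poset.isEquivalence P
              ; reflexive     = λ e → γ⇒L i (lhs≤rhs e)
              ; trans         = LexP.trans
              }
            ; antisym = λ (p , f) (r , g) → uncurry Sym._,_ (N-antisym i (f r) (g p))
            }
          ; total = LexP.total
          } , γ⇒L i
          where
          module LexP = IsTotalPreorder
            (lex-isTotalPreorder (H.refine-isTotalPreorder i T-isTotalPreorder)
                                 (N-isTotalPreorder i))

        ⋂L⇒γ : ⋂ L ⇒ γ
        ⋂L⇒γ {x} {y} l = proj₁ ⋂α⇔γ α-xy
          where
          Q-xy : Q x y
          Q-xy i = H.refine⇒boxPreorder i {T} (proj₁ (l i))
          α-xy : ∀ k → α k x y
          α-xy k with proj₁ (l k)
          ... | inj₁ (p , _)     = p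
          -- The empty box gives `T y x`, while `Q-xy` gives `T x y`. So the pair shares a box of
          -- every `α i`, and every `E i` leaves the decision to `N i`.
          ... | inj₂ (_ , _ , t) = γ⇒α k (M-antisym (N-i₀⇒M (N-xy i₀)) (N-i₁⇒flip-M (N-xy i₁)))
            where
            N-xy : ∀ i → N i x y
            N-xy i = proj₂ (l i)
              (H.boxPreorder⇒refine i T-isTotalPreorder (T-antisym t (Q⇒T Q-xy) i) t (Q⇒T Q-xy))

        ⋂L⇔γ : ⋂ L ⇔ γ
        ⋂L⇔γ = ⋂L⇒γ , λ p i → γ⇒L i p

      -- Half-space dimension at least two.

      hsdim≥2⇒dim : (I : Set ℓ) → Hsdim≡ γ I → Fin 2 ↣ I → Dim≡ P I
      hsdim≥2⇒dim I (r , minimal) two = realizer , λ J s → minimal J (realizer⇒halfSpaceRealizer s)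
        where
        module r = Realizer r
        module two = Injection two
        i₀≢i₁ : two.to zero ≢ two.to (suc zero)
        i₀≢i₁ e with () ← two.injective e
        open LinearExtensions r.member r.member-K r.intersection
               (two.to zero) (two.to (suc zero)) i₀≢i₁ using (L; L-isLinearExtension; ⋂L⇔γ)

        -- The L i need not be distinct.  One representative of each gives a
        -- half-space realizer indexed by a subset of I, which minimality of I
        -- makes equinumerous with I.
        _∼_ : Rel I ℓ
        i ∼ j = L i ⇔ L j

        representatives : Σ[ M ∈ Pred I ℓ ] (∀ {i j} → i ∈ M → j ∈ M → i ∼ j → i ≡ j) ×
                          (∀ i → ∃[ j ] j ∈ M × j ∼ i)
        representatives = transversal {_∼_ = _∼_} (id , id) (λ (f , g) → g , f)

        R : Pred I ℓ
        R = proj₁ representatives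

        R-distinct : ∀ {i j} → i ∈ R → j ∈ R → i ∼ j → i ≡ j
        R-distinct = proj₁ (proj₂ representatives)

        covers : ∀ i → ∃[ j ] j ∈ R × j ∼ i
        covers = proj₂ (proj₂ representatives)

        -- The refinement type stores an irrelevant proof, so that equal values give equal elements;
        -- excluded middle recovers the proof.
        value∈R : (j : [ i ∈ I ∣ R i ]) → value j ∈ R
        value∈R (_ , [ p ]) = recompute em p

        value-injective : ∀ {i j : [ i ∈ I ∣ R i ]} → value i ≡ value j → i ≡ j
        value-injective {_ , [ _ ]} {_ , [ _ ]} refl = refl

        reduced : Realizer IsHalfSpace γ [ i ∈ I ∣ R i ]
        reduced = record
          { member       = λ i → L (value i)
          ; member-K     = λ i → linearExtension⇒halfSpace (L-isLinearExtension (value i))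
          ; distinct     = λ {i} {j} e → value-injective (R-distinct (value∈R i) (value∈R j) e)
          ; nonempty     = let j , p , _ = covers r.nonempty in j , [ p ]
          ; intersection = (λ l → proj₁ ⋂L⇔γ (λ i →
                             let j , p , e = covers i in proj₁ e (l (j , [ p ]))))
                         , (λ p i → proj₂ ⋂L⇔γ p (value i))
          }

        module F = Injection (minimal _ reduced)

        -- Reindexing along this bijection makes `I` itself, not a subset of it, the index type.
        open CantorBernstein {M = R} (λ i → value (F.to i))
          (λ e → F.injective (value-injective e)) (λ i → value∈R (F.to i))

        realizer : Realizer (IsLinearExtension P) γ I
        realizer = record
          { member       = λ i → L (to i)
          ; member-K     = λ i → L-isLinearExtension (to i)
          ; distinct     = λ {i} {j} e → to-injective (R-distinct (to∈M i) (to∈M j) e)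
          ; nonempty     = r.nonempty
          ; intersection = (λ l → proj₁ ⋂L⇔γ (λ i →
                             let j , p , e = covers i
                                 k , k↦j   = to-surjective p
                             in proj₁ e (subst (λ m → L m _ _) k↦j (l k))))
                         , (λ p i → proj₂ ⋂L⇔γ p (to i))
          }

      -- Half-space dimension one.

      module _ (h : IsHalfSpace γ) where
        open HalfSpace h using (α∪β; incomparable⇒emptyBox)

        -- Distinct `γ`-incomparable points would share an empty box, so `γ` is total and realizes
        -- itself. The lower bound is the nonemptiness of realizers.
        noEmptyBox⇒dim1 : ¬ HasNontrivialEmptyBox h → Dim≡ P (Lift ℓ (Fin 1))
        noEmptyBox⇒dim1 ¬box = realizer , λ J s → mk↣ {to = λ _ → Realizer.nonempty s}
                                                     (λ { {lift zero} {lift zero} _ → refl })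
          where
          total : Total γ
          total x y with α∪β x y | α∪β y x
          ... | inj₁ p | _      = inj₁ p
          ... | _      | inj₁ r = inj₂ r
          ... | inj₂ p | inj₂ r with em {P = x ≡ y}
          ...   | yes refl = inj₁ γ.refl
          ...   | no x≢y   = contradiction
            (_ , incomparable⇒emptyBox p r x≢y , x , y , inj₁ (γ.refl , γ.refl) , inj₂ (p , r) , x≢y) ¬box
          realizer : Realizer (IsLinearExtension P) γ (Lift ℓ (Fin 1))
          realizer = record
            { member       = λ _ → γ
            ; member-K     = λ _ → record { isPartialOrder = Poset.isPartialOrder P ; total = total } , id
            ; distinct     = λ { {lift zero} {lift zero} _ → refl }
            ; nonempty     = lift zero
            ; intersection = (λ p → p (lift zero)) , λ p _ → p
            }

        emptyBox⇒dim2 : HasNontrivialEmptyBox h → Dim≡ P (Lift ℓ (Fin 2))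
        emptyBox⇒dim2 (B , (_ , α∩B²⇔Δ) , x , y , x∈B , y∈B , x≢y) = realizer , minimal
          where
          ¬xy : ¬ γ x y
          ¬xy p = x≢y (proj₁ (proj₁ α∩B²⇔Δ (p , x∈B , y∈B)))
          ¬yx : ¬ γ y x
          ¬yx p = x≢y (sym (proj₁ (proj₁ α∩B²⇔Δ (p , y∈B , x∈B))))

          open LinearExtensions {I = Lift ℓ (Fin 2)} (λ _ → γ) (λ _ → h)
                 ((λ p → p (lift zero)) , λ p _ → p) (lift zero) (lift (suc zero)) (λ ())

          L-total : ∀ i → Total (L i)
          L-total i = IsTotalOrder.total (proj₁ (L-isLinearExtension i))

          -- Otherwise `L i` would lie inside `γ`, and its totality would make `x` and `y`
          -- comparable in `γ`.
          notAllEqual : ∀ i → ¬ (∀ j → L i ⇒ L j)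
          notAllEqual i f with L-total i x y
          ... | inj₁ p = ¬xy (⋂L⇒γ (λ j → f j p))
          ... | inj₂ p = ¬yx (⋂L⇒γ (λ j → f j p))

          distinct : ∀ {i j} → L i ⇔ L j → i ≡ j
          distinct {lift zero}       {lift zero}       _ = refl
          distinct {lift (suc zero)} {lift (suc zero)} _ = refl
          distinct {lift zero} {lift (suc zero)} (f , _) =
            ⊥-elim (notAllEqual (lift zero) λ { (lift zero) → id ; (lift (suc zero)) → f })
          distinct {lift (suc zero)} {lift zero} (_ , g) =
            ⊥-elim (notAllEqual (lift zero) λ { (lift zero) → id ; (lift (suc zero)) → g })

          realizer : Realizer (IsLinearExtension P) γ (Lift ℓ (Fin 2))
          realizer = record
            { member       = L
            ; member-K     = L-isLinearExtension
            ; distinct     = distinct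
            ; nonempty     = lift zero
            ; intersection = ⋂L⇔γ
            }

          minimal : (J : Set ℓ) → Realizer (IsLinearExtension P) γ J → Lift ℓ (Fin 2) ↣ J
          minimal J s = mk↣ {to = f} f-injective
            where
            open Realizer s using (member; member-K; intersection)
            separating : ∀ {u v} → ¬ γ u v → ∃[ j ] ¬ member j u v
            separating ¬uv = decidable-stable em λ none → ¬uv (proj₁ intersection
              λ j → decidable-stable em λ ¬m → none (j , ¬m))
            j₀ = separating ¬xy
            j₁ = separating ¬yx
            -- A single total relation cannot omit both `(x , y)` and `(y , x)`.
            j₀≢j₁ : proj₁ j₀ ≢ proj₁ j₁
            j₀≢j₁ e with IsTotalOrder.total (proj₁ (member-K (proj₁ j₀))) x y
            ... | inj₁ p = proj₂ j₀ p
            ... | inj₂ p = proj₂ j₁ (subst (λ j → member j y x) e p)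
            f : Lift ℓ (Fin 2) → J
            f (lift zero)       = proj₁ j₀
            f (lift (suc zero)) = proj₁ j₁
            f-injective : ∀ {i j} → f i ≡ f j → i ≡ j
            f-injective {lift zero}       {lift zero}       _ = refl
            f-injective {lift (suc zero)} {lift (suc zero)} _ = refl
            f-injective {lift zero}       {lift (suc zero)} e = contradiction e j₀≢j₁
            f-injective {lift (suc zero)} {lift zero}       e = contradiction (sym e) j₀≢j₁

theorem2p15 : (∀ {ℓ} → ExcludedMiddle ℓ) →
    (∀ {c ℓ₁ ℓ₂ p} → ZornsLemma c ℓ₁ ℓ₂ p) →
    ∀ {ℓ} (A : Set ℓ) (γ : Rel A ℓ) (q : IsQuasiorder γ) →
    (Hsdim≡ γ (Lift ℓ (Fin 1)) →
    IsHalfSpace γ ×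
    ((h : IsHalfSpace γ) →
    (¬ HasNontrivialEmptyBox h → Dim≡ (quotientPoset q) (Lift ℓ (Fin 1))) ×
    (HasNontrivialEmptyBox h → Dim≡ (quotientPoset q) (Lift ℓ (Fin 2))))) ×
    ((I : Set ℓ) → Hsdim≡ γ I → Fin 2 ↣ I → Dim≡ (quotientPoset q) I)
theorem2p15 em zorn A γ q =
  (λ (r , _) →
    let open Realizer r
    -- The intersection of a one-member family is that member, so `γ` is equivalent to it.
    in isHalfSpace-resp-⇔
         ((λ p → proj₁ intersection λ { (lift zero) → p }) , λ p → proj₂ intersection p (lift zero))
         (member-K (lift zero))
     , λ h → noEmptyBox⇒dim1 em zorn q h , emptyBox⇒dim2 em zorn q h)
  , hsdim≥2⇒dim em zorn q
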